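{- For $n \ge 8$, let $\mu'(n)$ be the minimum number of edges of a (not necessarily connected) non-prime graph of order $n$. Then $\mu'(n) \le n$.
   Context: Graphs are finite and simple. A prime labeling of a graph $G$ of order $n$ is a bijection $\alpha: V(G) \to \{1,2,\dots,n\}$ such that $\gcd(\alpha(u),\alpha(v)) = 1$ for every edge $uv \in E(G)$. $G$ is prime if it admits a prime labeling, and non-prime otherwise. -}

module Defs where

open import Data.Fin using (Fin; toℕ; _<?_)
open import Data.List using (length; filter; cartesianProduct; allFin)
open import Data.Nat using (ℕ; suc; _≤_)
open import Data.Nat.GCD using (gcd)
open import Data.Product using (_×_; _,_; Σ-syntax)
open import Function.Bundles using (_⤖_; module Bijection)
open import Level using (0ℓ)
open import Relation.Binary using (Rel; Symmetric; Irreflexive; Decidable)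
open import Relation.Binary.PropositionalEquality using (_≡_)
open import Relation.Nullary using (¬_)
open import Relation.Nullary.Decidable using (_×-dec_)

-- Finite simple graphs of order n, with vertex set Fin n.
record Graph (n : ℕ) : Set₁ where
  field
    Adj    : Rel (Fin n) 0ℓ
    sym    : Symmetric Adj
    irrefl : Irreflexive _≡_ Adj
    adj?   : Decidable Adj

-- Each undirected edge is counted once, as the pair (u , v) with u < v.
numEdges : ∀ {n} → Graph n → ℕ
numEdges {n} G =
  length (filter (λ (u , v) → (u <? v) ×-dec adj? u v)
                 (cartesianProduct (allFin n) (allFin n)))
  where open Graph G

-- The label set {1, …, n} is represented by Fin n, i standing for 1 + toℕ i.
labelValue : ∀ {n} → Fin n → ℕ
labelValue i = suc (toℕ i)

record PrimeLabeling {n : ℕ} (G : Graph n) : Set where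
  open Graph G
  field
    α       : Fin n ⤖ Fin n
    coprime : ∀ {u v} → Adj u v →
              gcd (labelValue (Bijection.to α u)) (labelValue (Bijection.to α v)) ≡ 1

NonPrime : ∀ {n} → Graph n → Set
NonPrime G = ¬ PrimeLabeling G

NonPrimeSize : ℕ → ℕ → Set₁
NonPrimeSize n m = Σ[ G ∈ Graph n ] (NonPrime G × numEdges G ≡ m)

IsMinimum : (ℕ → Set₁) → ℕ → Set₁
IsMinimum P m = P m × (∀ k → P k → m ≤ k)

-- Isμ′ n m says that m is the value of μ′(n).  The minimum is unique when it
-- exists, but its existence (that some non-prime graph of order n exists) is
-- not built in.
Isμ′ : ℕ → ℕ → Set₁
Isμ′ n = IsMinimum (NonPrimeSize n)

{-# OPTIONS --safe #-}

-- Split the vertices into consecutive triples and join any two vertices of the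
-- same triple.  In a prime labeling the ⌊n/2⌋ vertices with even labels are
-- pairwise non-adjacent, so they lie in distinct triples; for n ≥ 8 there are
-- fewer than ⌊n/2⌋ triples, and this graph has at most n edges.  The minimum
-- exists because the existence of a non-prime graph with m edges is decidable:
-- up to equivalence of adjacency there are finitely many graphs, and finitely
-- many labelings of each.
module Submission where

open import Data.Bool using (Bool; T)
open import Data.Bool.Properties using (T?)
open import Data.Fin using (Fin; zero; suc; toℕ; fromℕ<; combine; remQuot; finToFun; funToFin)
open import Data.Fin.Properties
  using (_≟_; any?; all?; toℕ-injective; toℕ<n; toℕ-fromℕ<; suc-injective; pigeonhole;
         injective⇒≤; <⇒≢; remQuot-combine; finToFun-funToFin)
open import Data.Fin.Subset.Properties using (anySubset?)
open import Data.List using (List; length; lookup; filter; cartesianProduct; allFin)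
open import Data.List.Membership.Propositional.Properties using (∈-lookup)
open import Data.List.Properties using (filter-≐)
open import Data.List.Relation.Unary.All as All using (All)
open import Data.List.Relation.Unary.All.Properties using (all-filter)
open import Data.List.Relation.Unary.AllPairs using (_∷_)
open import Data.List.Relation.Unary.Unique.Propositional using (Unique)
import Data.List.Relation.Unary.Unique.Propositional.Properties as Unique
open import Data.Nat using (ℕ; zero; suc; _+_; _*_; _/_; ⌊_/2⌋; _≤_; _<_; z≤n; s≤s; s≤s⁻¹)
open import Data.Nat.Divisibility using (_∣_; ∣1⇒≡1; ∣m∣n⇒∣m+n; ∣-refl)
open import Data.Nat.DivMod using (m/n≡1+[m∸n]/n; /-monoˡ-≤; m<n*o⇒m/o<n)
open import Data.Nat.GCD using (gcd; gcd-greatest)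
open import Data.Nat.Induction using (<-rec)
import Data.Nat.Properties as ℕ
open import Data.Product using (∃; ∃-syntax; _×_; _,_; proj₁; proj₂; uncurry)
open import Data.Sum using (_⊎_; inj₁; [_,_]; swap)
open import Data.Vec using (Vec; tabulate) renaming (lookup to vlookup)
open import Data.Vec.Properties using (lookup∘tabulate)
open import Defs
open import Function using (_∘_; mk⤖; case_of_; module Bijection)
open import Function.Consequences.Propositional using (strictlySurjective⇒surjective)
open import Level using (Level)
open import Relation.Binary using (Rel; _⇒_)
open import Relation.Binary.PropositionalEquality
  using (_≡_; _≢_; _≗_; refl; sym; trans; cong; cong₂; subst; subst₂; ≢-sym)
open import Relation.Nullary using (Dec; yes; no; ¬_; contradiction)
open import Relation.Nullary.Decidable
  using (isYes; map′; ¬?; _×-dec_; _⊎-dec_; _→-dec_; toWitness; fromWitness)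
open import Relation.Unary using (Decidable)

private variable
  a p : Level
  A : Set a
  m n : ℕ

-- Finite search, least witnesses, and counting by injection.

-- Functions between finite sets have finitely many codes. Decoding the code of `f` returns `f` only
-- pointwise, hence the demand that `P` respect `≗`.
anyFunction? : {P : (Fin m → Fin n) → Set p} → (∀ {f g} → f ≗ g → P f → P g) →
               Decidable P → Dec (∃ P)
anyFunction? resp P? =
  map′ (λ (k , Pk) → finToFun k , Pk)
       (λ (f , Pf) → funToFin f , resp (sym ∘ finToFun-funToFin f) Pf)
       (any? (P? ∘ finToFun))

-- Strong induction on the witness: either a smaller one exists, found by bounded search, or `m` is
-- already least.
minimum-exists : {P : ℕ → Set₁} → Decidable P → ∀ m → P m → ∃[ k ] (IsMinimum P k × k ≤ m)
minimum-exists {P} P? = <-rec _ step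
  where
  step : ∀ m → (∀ {k} → k < m → P k → ∃[ l ] (IsMinimum P l × l ≤ k)) →
         P m → ∃[ k ] (IsMinimum P k × k ≤ m)
  step m rec Pm with ℕ.anyUpTo? P? m
  ... | yes (k , k<m , Pk) with l , min , l≤k ← rec k<m Pk =
    l , min , ℕ.≤-trans l≤k (ℕ.<⇒≤ k<m)
  ... | no none = m , (Pm , λ k Pk → ℕ.≮⇒≥ λ k<m → none (k , k<m , Pk)) , ℕ.≤-refl

Unique⇒lookup-injective : {xs : List A} → Unique xs → ∀ i j → lookup xs i ≡ lookup xs j → i ≡ j
Unique⇒lookup-injective (_  ∷ _)  zero    zero    _  = refl
Unique⇒lookup-injective (x∉ ∷ _)  zero    (suc j) eq = contradiction eq (All.lookup x∉ (∈-lookup j))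
Unique⇒lookup-injective (x∉ ∷ _)  (suc i) zero    eq =
  contradiction (sym eq) (All.lookup x∉ (∈-lookup i))
Unique⇒lookup-injective (_  ∷ un) (suc i) (suc j) eq = cong suc (Unique⇒lookup-injective un i j eq)

length≤ : {P : A → Set p} {xs : List A} → Unique xs → All P xs → (f : A → Fin n) →
          (∀ {x y} → P x → P y → f x ≡ f y → x ≡ y) → length xs ≤ n
length≤ {xs = xs} un Pxs f f-inj = injective⇒≤ {f = f ∘ lookup xs} λ {i} {j} eq →
  Unique⇒lookup-injective un i j
    (f-inj (All.lookup Pxs (∈-lookup i)) (All.lookup Pxs (∈-lookup j)) eq)

-- Deciding whether a graph is prime.

module _ (G : Graph n) where
  open Graph G using (Adj; adj?)

  -- Bijectivity is unbundled into conditions on a plain function, each decided by running over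
  -- `Fin n`.
  IsPrimeLabeling : (Fin n → Fin n) → Set
  IsPrimeLabeling f =
    (∀ u v → f u ≡ f v → u ≡ v) ×
    (∀ y → ∃[ x ] f x ≡ y) ×
    (∀ u v → Adj u v → gcd (labelValue (f u)) (labelValue (f v)) ≡ 1)

  isPrimeLabeling? : Decidable IsPrimeLabeling
  isPrimeLabeling? f =
    all? (λ u → all? λ v → (f u ≟ f v) →-dec (u ≟ v)) ×-dec
    all? (λ y → any? λ x → f x ≟ y) ×-dec
    all? (λ u → all? λ v → adj? u v →-dec (gcd (labelValue (f u)) (labelValue (f v)) ℕ.≟ 1))

  isPrimeLabeling-resp-≗ : ∀ {f g} → f ≗ g → IsPrimeLabeling f → IsPrimeLabeling g
  isPrimeLabeling-resp-≗ f≗g (inj , surj , cop) =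
    (λ u v eq → inj u v (trans (f≗g u) (trans eq (sym (f≗g v))))) ,
    (λ y → let x , eq = surj y in x , trans (sym (f≗g x)) eq) ,
    (λ u v uv → subst₂ (λ a b → gcd (labelValue a) (labelValue b) ≡ 1) (f≗g u) (f≗g v) (cop u v uv))

  primeLabeling? : Dec (PrimeLabeling G)
  primeLabeling? = map′ to from (anyFunction? isPrimeLabeling-resp-≗ isPrimeLabeling?)
    where
    to : ∃ IsPrimeLabeling → PrimeLabeling G
    to (f , inj , surj , cop) = record
      { α       = mk⤖ ((λ {u} {v} → inj u v) , strictlySurjective⇒surjective surj)
      ; coprime = λ {u} {v} → cop u v
      }

    from : PrimeLabeling G → ∃ IsPrimeLabeling
    from L = Bijection.to α , (λ u v → Bijection.injective α) ,
             Bijection.strictlySurjective α , (λ u v → coprime)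
      where open PrimeLabeling L

-- Adjacency matrices and the decidability of `NonPrimeSize`.

module _ {G H : Graph n} where
  private
    module G = Graph G
    module H = Graph H

  nonPrime-mono : G.Adj ⇒ H.Adj → NonPrime G → NonPrime H
  nonPrime-mono G⇒H ¬G L = ¬G record { α = α ; coprime = coprime ∘ G⇒H }
    where open PrimeLabeling L

  numEdges-cong : G.Adj ⇒ H.Adj → H.Adj ⇒ G.Adj → numEdges G ≡ numEdges H
  numEdges-cong G⇒H H⇒G = cong length
    (filter-≐ _ _ ((λ (u<v , uv) → u<v , G⇒H uv) , (λ (u<v , uv) → u<v , H⇒G uv))
      (cartesianProduct (allFin n) (allFin n)))

module _ (S : Vec Bool (n * n)) where
  private
    R : Rel (Fin n) _
    R u v = T (vlookup S (combine u v))

  -- Symmetrizing and discarding the diagonal makes every bit vector code a simple graph, so the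
  -- search needs no validity check.
  fromMatrix : Graph n
  fromMatrix = record
    { Adj    = λ u v → u ≢ v × (R u v ⊎ R v u)
    ; sym    = λ (u≢v , r) → ≢-sym u≢v , swap r
    ; irrefl = λ u≡v (u≢v , _) → u≢v u≡v
    ; adj?   = λ u v → ¬? (u ≟ v) ×-dec (T? _ ⊎-dec T? _)
    }

module _ (G : Graph n) where
  open Graph G renaming (sym to adj-sym)

  toMatrix : Vec Bool (n * n)
  toMatrix = tabulate (λ i → isYes (uncurry adj? (remQuot n i)))

  lookup-toMatrix : ∀ u v → vlookup toMatrix (combine u v) ≡ isYes (adj? u v)
  lookup-toMatrix u v =
    trans (lookup∘tabulate _ (combine u v)) (cong (isYes ∘ uncurry adj?) (remQuot-combine u v))

  fromMatrix∘toMatrix⇒ : Graph.Adj (fromMatrix toMatrix) ⇒ Adj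
  fromMatrix∘toMatrix⇒ (_ , r) = [ to , adj-sym ∘ to ] r
    where
    to : ∀ {u v} → T (vlookup toMatrix (combine u v)) → Adj u v
    to {u} {v} t = toWitness {a? = adj? u v} (subst T (lookup-toMatrix u v) t)

  fromMatrix∘toMatrix⇐ : Adj ⇒ Graph.Adj (fromMatrix toMatrix)
  fromMatrix∘toMatrix⇐ {u} {v} uv =
    (λ u≡v → irrefl u≡v uv) , inj₁ (subst T (sym (lookup-toMatrix u v)) (fromWitness uv))

-- A graph is recovered from its matrix only up to equivalence of adjacency, which preserves both
-- non-primality and the number of edges.
nonPrimeSize? : ∀ n → Decidable (NonPrimeSize n)
nonPrimeSize? n m = map′
  (λ (S , H) → fromMatrix S , H)
  (λ (G , ¬G , eq) → let G⇐ = fromMatrix∘toMatrix⇒ G ; G⇒ = fromMatrix∘toMatrix⇐ G in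
     toMatrix G , nonPrime-mono {G = G} {fromMatrix (toMatrix G)} G⇒ ¬G ,
     trans (numEdges-cong {G = fromMatrix (toMatrix G)} {G} G⇐ G⇒) eq)
  -- A subset of `Fin (n * n)` is a `Vec Bool (n * n)`, so this search runs over all matrices.
  (anySubset? λ S → ¬? (primeLabeling? (fromMatrix {n} S)) ×-dec (numEdges (fromMatrix {n} S) ℕ.≟ m))

-- The disjoint triangles and their edge count.

block : Fin n → ℕ
block u = toℕ u / 3

triangles : ∀ n → Graph n
triangles n = record
  { Adj    = λ u v → u ≢ v × block u ≡ block v
  ; sym    = λ (u≢v , eq) → ≢-sym u≢v , sym eq
  ; irrefl = λ u≡v (u≢v , _) → u≢v u≡v
  ; adj?   = λ u v → ¬? (u ≟ v) ×-dec (block u ℕ.≟ block v)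
  }

-- Moving up by 3 or more raises the quotient by at least 1.
/3≡⇒<3+ : ∀ {k l} → k / 3 ≡ l / 3 → l < 3 + k
/3≡⇒<3+ {k} {l} eq = ℕ.≰⇒> λ 3+k≤l → ℕ.<-irrefl eq (begin-strict
  k / 3        <⟨ ℕ.n<1+n _ ⟩
  1 + k / 3    ≡⟨ m/n≡1+[m∸n]/n {3 + k} {3} (ℕ.m≤m+n 3 k) ⟨
  (3 + k) / 3  ≤⟨ /-monoˡ-≤ 3 3+k≤l ⟩
  l / 3        ∎)
  where open ℕ.≤-Reasoning

IsEdge : Fin n × Fin n → Set
IsEdge (u , v) = toℕ u < toℕ v × block u ≡ block v

edge-gap : {u v : Fin n} → IsEdge (u , v) → toℕ v ≢ 1 + toℕ u → toℕ v ≡ 2 + toℕ u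
edge-gap (u<v , eq) v≢1+u =
  ℕ.≤-antisym (s≤s⁻¹ (/3≡⇒<3+ eq)) (ℕ.≤∧≢⇒< u<v (≢-sym v≢1+u))

-- In the triple {x, x+1, x+2} the edges {x, x+1}, {x+1, x+2} and {x, x+2} are
-- charged to x, x+1 and x+2, so distinct edges are charged to distinct vertices.
charge : Fin n × Fin n → Fin n
charge (u , v) with toℕ v ℕ.≟ 1 + toℕ u
... | yes _ = u
... | no  _ = v

-- Rules out the one possible clash of charges: a short edge charged to its lower end `u` and a long
-- edge charged to its upper end `u`. Otherwise `w` and `v`, which is `3 + w`, would share a block.
short-long-distinct : {u v w : Fin n} → IsEdge (u , v) → toℕ v ≡ 1 + toℕ u →
                      IsEdge (w , u) → toℕ u ≢ 2 + toℕ w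
short-long-distinct (_ , uv) v≡1+u (_ , wu) u≡2+w =
  ℕ.<-irrefl (trans v≡1+u (cong suc u≡2+w)) (/3≡⇒<3+ (trans wu uv))

charge-injective : {e f : Fin n × Fin n} → IsEdge e → IsEdge f → charge e ≡ charge f → e ≡ f
charge-injective {e = u , v} {x , y} e f eq with toℕ v ℕ.≟ 1 + toℕ u | toℕ y ℕ.≟ 1 + toℕ x
charge-injective e f refl | yes p | yes q = cong₂ _,_ refl (toℕ-injective (trans p (sym q)))
charge-injective e f refl | yes p | no  q = contradiction (edge-gap f q) (short-long-distinct e p f)
charge-injective e f refl | no  p | yes q = contradiction (edge-gap e p) (short-long-distinct f q e)
charge-injective e f refl | no  p | no  q = cong₂ _,_
  (toℕ-injective (ℕ.+-cancelˡ-≡ 2 _ _ (trans (sym (edge-gap e p)) (edge-gap f q)))) refl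

numEdges-triangles : ∀ n → numEdges (triangles n) ≤ n
numEdges-triangles n = length≤
  (Unique.filter⁺ _ (Unique.cartesianProduct⁺ (Unique.allFin⁺ n) (Unique.allFin⁺ n)))
  (All.map (λ (u<v , _ , eq) → u<v , eq) (all-filter _ (cartesianProduct (allFin n) (allFin n))))
  charge charge-injective

-- Even labels and non-primality.

-- Index `i` stands for label `i + 1`, so the labels 2, 4, 6, ... sit at the indices 1, 3, 5, ....
evenLabel : ∀ n → Fin ⌊ n /2⌋ → Fin n
evenLabel (suc (suc n)) zero    = suc zero
evenLabel (suc (suc n)) (suc i) = suc (suc (evenLabel n i))

evenLabel-injective : ∀ n {i j} → evenLabel n i ≡ evenLabel n j → i ≡ j
evenLabel-injective (suc (suc n)) {zero}  {zero}  _  = refl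
evenLabel-injective (suc (suc n)) {suc i} {suc j} eq =
  cong suc (evenLabel-injective n (suc-injective (suc-injective eq)))

2∣evenLabel : ∀ n i → 2 ∣ labelValue (evenLabel n i)
2∣evenLabel (suc (suc n)) zero    = ∣-refl
2∣evenLabel (suc (suc n)) (suc i) = ∣m∣n⇒∣m+n ∣-refl (2∣evenLabel n i)

-- Raising `n` by 2 raises the right side by 3; the summand 1 covers the base case `n = 1`.
n≤1+⌊n/2⌋*3 : ∀ n → n ≤ 1 + ⌊ n /2⌋ * 3
n≤1+⌊n/2⌋*3 zero          = z≤n
n≤1+⌊n/2⌋*3 (suc zero)    = s≤s z≤n
n≤1+⌊n/2⌋*3 (suc (suc n)) = s≤s (s≤s (ℕ.m≤n⇒m≤1+n (n≤1+⌊n/2⌋*3 n)))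

fewTriples : 8 ≤ n → ∃[ q ] (q < ⌊ n /2⌋ × n ≤ q * 3)
fewTriples 8≤n with j , refl ← ℕ.m≤n⇒∃[o]m+o≡n 8≤n =
  -- With `n = 8 + j`, `⌊ n /2⌋` computes to `4 + ⌊ j /2⌋`, one more than this `q`, and `q * 3` to
  -- `9 + ⌊ j /2⌋ * 3`, where 9 = 8 + 1.
  3 + ⌊ j /2⌋ , ℕ.≤-refl , ℕ.+-monoʳ-≤ 8 (n≤1+⌊n/2⌋*3 j)

triangles-nonPrime : 8 ≤ n → NonPrime (triangles n)
-- There are more even labels than block indices, so two vertices with even labels share a block.
-- They are adjacent, so 2 divides a gcd equal to 1.
triangles-nonPrime {n} 8≤n L = case pigeonhole q<⌊n/2⌋ (λ i → fromℕ< (block<q (vertex i))) of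
  λ (i , j , i<j , eq) → contradiction
    (∣1⇒≡1 (subst (2 ∣_) (coprime (vertex-distinct i<j , sameBlock eq))
      (gcd-greatest (2∣label i) (2∣label j))))
    λ()
  where
  open PrimeLabeling L

  q : ℕ
  q = proj₁ (fewTriples 8≤n)

  q<⌊n/2⌋ : q < ⌊ n /2⌋
  q<⌊n/2⌋ = proj₁ (proj₂ (fewTriples 8≤n))

  block<q : (u : Fin n) → block u < q
  block<q u = m<n*o⇒m/o<n (ℕ.<-≤-trans (toℕ<n u) (proj₂ (proj₂ (fewTriples 8≤n))))

  vertex : Fin ⌊ n /2⌋ → Fin n
  vertex i = proj₁ (Bijection.strictlySurjective α (evenLabel n i))

  label-vertex : ∀ i → Bijection.to α (vertex i) ≡ evenLabel n i
  label-vertex i = proj₂ (Bijection.strictlySurjective α (evenLabel n i))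

  2∣label : ∀ i → 2 ∣ labelValue (Bijection.to α (vertex i))
  2∣label i = subst (λ x → 2 ∣ labelValue x) (sym (label-vertex i)) (2∣evenLabel n i)

  vertex-distinct : ∀ {i j} → toℕ i < toℕ j → vertex i ≢ vertex j
  vertex-distinct {i} {j} i<j eq = <⇒≢ i<j (evenLabel-injective n
    (trans (sym (label-vertex i)) (trans (cong (Bijection.to α) eq) (label-vertex j))))

  sameBlock : ∀ {i j} → fromℕ< (block<q (vertex i)) ≡ fromℕ< (block<q (vertex j)) →
              block (vertex i) ≡ block (vertex j)
  sameBlock eq = trans (sym (toℕ-fromℕ< _)) (trans (cong toℕ eq) (toℕ-fromℕ< _))

theorem10p5 : ∀ (n : ℕ) → 8 ≤ n → ∃[ m ] (Isμ′ n m × m ≤ n)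
theorem10p5 n 8≤n =
  -- The starting witness, left as `_`, is fixed by `refl` to be `numEdges (triangles n)`.
  let m , isMin , m≤ = minimum-exists (nonPrimeSize? n) _
                         (triangles n , triangles-nonPrime 8≤n , refl)
  in m , isMin , ℕ.≤-trans m≤ (numEdges-triangles n)
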